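{- Let $n$ be a non-negative integer and let $a,b$ be integers with $\gcd(a,b)=1$, $b\neq 0$ and $b\neq\pm1$. Let $C_k=\frac{1}{k+1}\binom{2k}{k}$ be the $k$-th Catalan number and let $M_N(a,b)=\sum_{k=0}^{\lfloor N/2\rfloor}\binom{N}{2k}C_k a^k b^{N-2k}$ be the generalized Motzkin number. Then $$\omega_b\big(M_{2n}(a,b)\big)=\omega_b(C_n),\qquad \omega_b\big(M_{2n+1}(a,b)\big)=1+\omega_b\big((2n+1)C_n\big).$$
   Context: For an integer $x$ with $x\neq 0,\pm1$ and a nonzero integer $y$, $\omega_x(y)$ denotes the largest non-negative integer $e$ such that $x^e$ divides $y$. -}

module Defs where

open import Data.Nat.Base as ℕ using (ℕ; zero; suc; ⌊_/2⌋; _∸_; z≤n; s≤s)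
import Data.Nat.Properties as ℕ
import Data.Nat.Divisibility as ℕ
import Data.Nat.DivMod as ℕ
open import Data.Nat.Combinatorics using (_C_; nC1≡n; nCk+nC[k+1]≡[n+1]C[k+1])
open import Data.Nat.Solver using (module +-*-Solver)
open import Data.Integer.Base using (ℤ; +_; -[1+_]; 0ℤ; 1ℤ; -1ℤ; _*_; _^_; ∣_∣)
open import Data.Integer.Properties using (+-*-semiring; abs-*; ∣i∣≡0⇒i≡0)
open import Data.Integer.Divisibility using (_∣_)
open import Data.Fin.Base using (toℕ)
open import Algebra.Properties.Semiring.Sum +-*-semiring using (sum⁺-syntax)
open import Data.Product.Base using (_×_; _,_)
open import Relation.Nullary using (Dec; yes; no; contradiction)
open import Relation.Binary.PropositionalEquality
  using (_≡_; _≢_; refl; sym; trans; cong; cong₂; subst; module ≡-Reasoning)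

catalan : ℕ → ℕ
catalan k = ((2 ℕ.* k) C k) ℕ./ suc k

motzkin : ℕ → ℤ → ℤ → ℤ
motzkin N a b =
  ∑[ i ≤ ⌊ N /2⌋ ]
    (let k = toℕ i in
     + (N C (2 ℕ.* k)) * + catalan k * a ^ k * b ^ (N ∸ 2 ℕ.* k))

IsGreatestExponent : ℤ → ℤ → ℕ → Set
IsGreatestExponent x y e = x ^ e ∣ y × (∀ f → x ^ f ∣ y → f ℕ.≤ e)

infix 4 _∣?_

_∣?_ : (x y : ℤ) → Dec (x ∣ y)
x ∣? y = ∣ x ∣ ℕ.∣? ∣ y ∣

greatestUpTo : ℤ → ℤ → ℕ → ℕ
greatestUpTo x y zero = zero
greatestUpTo x y (suc e) with x ^ suc e ∣? y
... | yes _ = suc e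
... | no  _ = greatestUpTo x y e

-- The search bound ∣ y ∣ loses nothing when x ≢ 0, ±1 and y ≢ 0
-- (see ω-isGreatestExponent); outside that domain the value is junk.
ω : ℤ → ℤ → ℕ
ω x y = greatestUpTo x y ∣ y ∣

greatestUpTo-∣ : ∀ x y n → x ^ greatestUpTo x y n ∣ y
greatestUpTo-∣ x y zero = ℕ.1∣ ∣ y ∣
greatestUpTo-∣ x y (suc n) with x ^ suc n ∣? y
... | yes p = p
... | no  _ = greatestUpTo-∣ x y n

greatestUpTo-max : ∀ x y n f → f ℕ.≤ n → x ^ f ∣ y → f ℕ.≤ greatestUpTo x y n
greatestUpTo-max x y zero f f≤0 _ = f≤0
greatestUpTo-max x y (suc n) f f≤ d with x ^ suc n ∣? y
... | yes _ = f≤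
... | no ¬p = greatestUpTo-max x y n f
  (ℕ.s≤s⁻¹ (ℕ.≤∧≢⇒< f≤ (λ f≡ → ¬p (subst (λ g → x ^ g ∣ y) f≡ d)))) d

abs-^ : ∀ x e → ∣ x ^ e ∣ ≡ ∣ x ∣ ℕ.^ e
abs-^ x zero = refl
abs-^ x (suc e) = trans (abs-* x (x ^ e)) (cong (∣ x ∣ ℕ.*_) (abs-^ x e))

1<∣x∣ : ∀ x → x ≢ 0ℤ → x ≢ 1ℤ → x ≢ -1ℤ → 1 ℕ.< ∣ x ∣
1<∣x∣ (+ 0)           x≢0 _ _ = contradiction refl x≢0
1<∣x∣ (+ 1)           _ x≢1 _ = contradiction refl x≢1
1<∣x∣ (+ suc (suc _)) _ _ _   = s≤s (s≤s z≤n)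
1<∣x∣ -[1+ 0 ]        _ _ x≢-1 = contradiction refl x≢-1
1<∣x∣ -[1+ suc _ ]    _ _ _   = s≤s (s≤s z≤n)

n<m^n : ∀ m n → 1 ℕ.< m → n ℕ.< m ℕ.^ n
n<m^n m zero 1<m = s≤s z≤n
n<m^n m (suc n) 1<m = begin
  2 ℕ.+ n                   ≤⟨ ℕ.+-mono-≤ (ℕ.≤-trans (s≤s z≤n) ih) ih ⟩
  m ℕ.^ n ℕ.+ m ℕ.^ n       ≡⟨ cong (m ℕ.^ n ℕ.+_) (ℕ.+-identityʳ _) ⟨
  2 ℕ.* m ℕ.^ n             ≤⟨ ℕ.*-monoˡ-≤ (m ℕ.^ n) 1<m ⟩
  m ℕ.* m ℕ.^ n             ∎
  where
  open ℕ.≤-Reasoning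
  ih = n<m^n m n 1<m

ω-isGreatestExponent : ∀ x y → x ≢ 0ℤ → x ≢ 1ℤ → x ≢ -1ℤ → y ≢ 0ℤ →
                       IsGreatestExponent x y (ω x y)
ω-isGreatestExponent x y x≢0 x≢1 x≢-1 y≢0 =
  greatestUpTo-∣ x y ∣ y ∣ , λ f d → greatestUpTo-max x y ∣ y ∣ f (bound f d) d
  where
  bound : ∀ f → x ^ f ∣ y → f ℕ.≤ ∣ y ∣
  bound f d = ℕ.≤-trans
    (ℕ.<⇒≤ (n<m^n ∣ x ∣ f (1<∣x∣ x x≢0 x≢1 x≢-1)))
    (subst (ℕ._≤ ∣ y ∣) (abs-^ x f)
      (ℕ.∣⇒≤ {{ℕ.≢-nonZero (λ eq → y≢0 (∣i∣≡0⇒i≡0 eq))}} d))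

absorption : ∀ n k → suc k ℕ.* (suc n C suc k) ≡ suc n ℕ.* (n C k)
absorption zero zero = refl
absorption zero (suc k) = ℕ.*-zeroʳ (suc (suc k))
absorption (suc n) zero =
  trans (ℕ.*-identityˡ _) (trans (nC1≡n (suc (suc n))) (sym (ℕ.*-identityʳ _)))
absorption (suc n) (suc k) = begin
  suc (suc k) ℕ.* (suc (suc n) C suc (suc k))
    ≡⟨ cong (suc (suc k) ℕ.*_) (nCk+nC[k+1]≡[n+1]C[k+1] (suc n) (suc k)) ⟨
  suc (suc k) ℕ.* (u ℕ.+ (suc n C suc (suc k)))
    ≡⟨ ℕ.*-distribˡ-+ (suc (suc k)) u _ ⟩
  (u ℕ.+ suc k ℕ.* u) ℕ.+ suc (suc k) ℕ.* (suc n C suc (suc k))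
    ≡⟨ cong₂ (λ p q → (u ℕ.+ p) ℕ.+ q) (absorption n k) (absorption n (suc k)) ⟩
  (u ℕ.+ suc n ℕ.* (n C k)) ℕ.+ suc n ℕ.* (n C suc k)
    ≡⟨ ℕ.+-assoc u _ _ ⟩
  u ℕ.+ (suc n ℕ.* (n C k) ℕ.+ suc n ℕ.* (n C suc k))
    ≡⟨ cong (u ℕ.+_) (ℕ.*-distribˡ-+ (suc n) (n C k) _) ⟨
  u ℕ.+ suc n ℕ.* ((n C k) ℕ.+ (n C suc k))
    ≡⟨ cong (λ v → u ℕ.+ suc n ℕ.* v) (nCk+nC[k+1]≡[n+1]C[k+1] n k) ⟩
  suc (suc n) ℕ.* u ∎
  where
  open ≡-Reasoning
  u = suc n C suc k

[k+1]∣2kCk : ∀ k → suc k ℕ.∣ (2 ℕ.* k) C k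
[k+1]∣2kCk k = ℕ.∣m+n∣m⇒∣n
  (subst (suc k ℕ.∣_) split (ℕ.m∣m*n {suc k} (2 ℕ.* c)))
  (subst (suc k ℕ.∣_) (absorption (2 ℕ.* k) k) (ℕ.m∣m*n _))
  where
  open +-*-Solver
  c = (2 ℕ.* k) C k
  split : suc k ℕ.* (2 ℕ.* c) ≡ suc (2 ℕ.* k) ℕ.* c ℕ.+ c
  split = solve 2 (λ k c → (con 1 :+ k) :* (con 2 :* c)
                        := (con 1 :+ con 2 :* k) :* c :+ c) refl k c

-- The truncating division in catalan is exact.
catalan-exact : ∀ k → suc k ℕ.* catalan k ≡ (2 ℕ.* k) C k
catalan-exact k = ℕ.m*[n/m]≡n ([k+1]∣2kCk k)

{-# OPTIONS --safe #-}

-- Write β = ∣ b ∣.  Only the summand k = n of M_{2n+e} (e = 0, 1) matters: it is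
-- c aⁿ bᵉ with c = binom(2n+e, 2n) C_n, and if β^w divides c then β^(e+w+1) divides
-- every other summand.  Indeed, for n = j + k with j ≥ 1, the coefficient
-- X = binom(2n+e, 2k) C_k satisfies D X = c S with D = binom(2j+e, j) and S an
-- integer: binom(n, j) binom(n+1, j) for e = 0, a Narayana number for e = 1.  So β^w
-- divides D X.  As D < 2^(2j), at most 2j - 1 successive nontrivial common factors
-- with β can be split off D, so β^w divides β^(2j-1) X, that is, β^(e+w+1) divides
-- X β^(2j+e).
module Submission where

open import Defs
open import Data.Nat.Base as ℕ using (ℕ; zero; suc; _!; ⌊_/2⌋; _∸_; z≤n; s≤s)
import Data.Nat.Properties as ℕ
import Data.Nat.Divisibility as ℕ
import Data.Nat.DivMod as ℕ
import Data.Nat.GCD as ℕ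
open import Data.Nat.Coprimality as Coprimality
  using (Coprime; gcd≡1⇒coprime; coprime-divisor)
open import Data.Nat.Combinatorics
  using (_C_; nC1≡n; nCn≡1; nCk≡nC[n∸k]; nCk+nC[k+1]≡[n+1]C[k+1];
         nCk≡n!/k![n-k]!; [n∸k]!k!∣n!)
open import Data.Nat.Tactic.RingSolver using (solve-∀)
open import Data.Integer.Base using (ℤ; +_; 0ℤ; 1ℤ; -1ℤ; _+_; _*_; _^_; ∣_∣)
import Data.Integer.Base as ℤ
import Data.Integer.Properties as ℤ
open import Data.Integer.Divisibility using (_∣_; *-cancelˡ-∣)
import Data.Integer.Divisibility.Signed as Signed
open import Data.Integer.GCD using (gcd)
open import Data.Fin.Base using (Fin; zero; suc; toℕ; inject₁; fromℕ)
open import Data.Fin.Properties using (toℕ<n; toℕ-inject₁; toℕ-fromℕ)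
open import Algebra.Properties.Semiring.Sum ℤ.+-*-semiring
  using (sum; sum⁺-syntax; sum-init-last)
open import Data.Product.Base using (_×_; _,_; proj₁)
open import Data.Sum.Base using (inj₁; inj₂)
open import Function.Base using (_∘_)
open import Relation.Nullary using (contradiction)
open import Relation.Binary.PropositionalEquality
  using (_≡_; _≢_; refl; sym; trans; cong; cong₂; subst; subst₂; module ≡-Reasoning)

-- Divisibility of powers

coprime-*ˡ : ∀ {m n k} → Coprime m k → Coprime n k → Coprime (m ℕ.* n) k
coprime-*ˡ m⊥k n⊥k (d∣mn , d∣k) =
  n⊥k (coprime-divisor (λ (e∣d , e∣m) → m⊥k (e∣m , ℕ.∣-trans e∣d d∣k)) d∣mn , d∣k)

coprime-^ˡ : ∀ {m k} e → Coprime m k → Coprime (m ℕ.^ e) k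
coprime-^ˡ zero    m⊥k = Coprimality.1-coprimeTo _
coprime-^ˡ (suc e) m⊥k = coprime-*ˡ m⊥k (coprime-^ˡ e m⊥k)

coprime-^ : ∀ {m k} e f → Coprime m k → Coprime (m ℕ.^ e) (k ℕ.^ f)
coprime-^ e f m⊥k = coprime-^ˡ e (Coprimality.sym (coprime-^ˡ f (Coprimality.sym m⊥k)))

-- Induction on `m` with `g = gcd x D`. If `g = 1`, then `D` is coprime to `x ^ w` and cancels. If
-- `g ≥ 2`, the quotient of `D` by `g` satisfies the halved bound, and `g`, moved over to `X`, is
-- replaced by its multiple `x`: one factor `x` is spent. At `m = 0` only `D = 1` is left.
^-∣-cancel : ∀ x w m D X .{{_ : ℕ.NonZero D}} → D ℕ.< 2 ℕ.^ suc m →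
             x ℕ.^ w ℕ.∣ D ℕ.* X → x ℕ.^ w ℕ.∣ x ℕ.^ m ℕ.* X
^-∣-cancel x w zero    1             X _ d = d
^-∣-cancel x w zero    (suc (suc _)) X (s≤s (s≤s ())) d
^-∣-cancel x w (suc m) D             X D< d with ℕ.gcd x D in eq
... | zero = contradiction (ℕ.gcd[m,n]≡0⇒n≡0 x eq) (ℕ.≢-nonZero⁻¹ D)
... | suc zero =
  ℕ.∣n⇒∣m*n (x ℕ.^ suc m) (coprime-divisor (coprime-^ˡ w (gcd≡1⇒coprime eq)) d)
... | g@(suc (suc _)) with subst (ℕ._∣ D) eq (ℕ.gcd[m,n]∣n x D)
...   | ℕ.divides q refl = begin
  x ℕ.^ w                       ∣⟨ ^-∣-cancel x w m q (g ℕ.* X) q<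
                                     (subst (x ℕ.^ w ℕ.∣_) (ℕ.*-assoc q g X) d) ⟩
  x ℕ.^ m ℕ.* (g ℕ.* X)         ∣⟨ ℕ.*-monoʳ-∣ (x ℕ.^ m) (ℕ.*-monoˡ-∣ X g∣x) ⟩
  x ℕ.^ m ℕ.* (x ℕ.* X)         ≡⟨ assoc-swap (x ℕ.^ m) x X ⟩
  x ℕ.^ suc m ℕ.* X             ∎
  where
  open ℕ.∣-Reasoning
  instance _ = ℕ.m*n≢0⇒m≢0 q
  g∣x : g ℕ.∣ x
  g∣x = subst (ℕ._∣ x) eq (ℕ.gcd[m,n]∣m x D)
  q< : q ℕ.< 2 ℕ.^ suc m
  q< = ℕ.*-cancelˡ-< 2 q (2 ℕ.^ suc m) (ℕ.≤-<-trans
    (subst (ℕ._≤ q ℕ.* g) (ℕ.*-comm q 2) (ℕ.*-monoʳ-≤ q (s≤s (s≤s z≤n)))) D<)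
  assoc-swap : ∀ p x X → p ℕ.* (x ℕ.* X) ≡ x ℕ.* p ℕ.* X
  assoc-swap = solve-∀

-- Binomial coefficients

-- The factorial formula as a product, with `l` in the role of `n ∸ k`: later computations need
-- neither division nor truncated subtraction.
nCk*k!*l! : ∀ {n} k l → k ℕ.+ l ≡ n → (n C k) ℕ.* (k ! ℕ.* l !) ≡ n !
nCk*k!*l! k l refl = begin
  (n C k) ℕ.* (k ! ℕ.* l !)
    ≡⟨ cong (λ v → (n C k) ℕ.* (k ! ℕ.* v !)) (ℕ.m+n∸m≡n k l) ⟨
  (n C k) ℕ.* (k ! ℕ.* (n ∸ k) !)
    ≡⟨ cong (ℕ._* (k ! ℕ.* (n ∸ k) !)) (nCk≡n!/k![n-k]! k≤n) ⟩
  (n ! ℕ./ (k ! ℕ.* (n ∸ k) !)) ℕ.* (k ! ℕ.* (n ∸ k) !)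
    ≡⟨ ℕ.m/n*n≡m (subst (ℕ._∣ n !) (ℕ.*-comm ((n ∸ k) !) (k !)) ([n∸k]!k!∣n! k≤n)) ⟩
  n ! ∎
  where
  open ≡-Reasoning
  n = k ℕ.+ l
  k≤n = ℕ.m≤m+n k l
  instance _ = k ℕ.!* (n ∸ k) !≢0

k!*l!∣[k+l]! : ∀ k l → k ! ℕ.* l ! ℕ.∣ (k ℕ.+ l) !
k!*l!∣[k+l]! k l = ℕ.divides ((k ℕ.+ l) C k) (sym (nCk*k!*l! k l refl))

nCk≢0 : ∀ k l → ℕ.NonZero ((k ℕ.+ l) C k)
nCk≢0 k l = ℕ.m*n≢0⇒m≢0 _
  {{subst ℕ.NonZero (sym (nCk*k!*l! k l refl)) ((k ℕ.+ l) ℕ.!≢0)}}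

catalan-! : ∀ k → catalan k ℕ.* (k ! ℕ.* suc k !) ≡ (2 ℕ.* k) !
catalan-! k = begin
  -- `suc k !` unfolds to `k ! + k * k !`, the shape expected by `regroup`.
  catalan k ℕ.* (k ! ℕ.* suc k !)           ≡⟨ regroup k (catalan k) (k !) ⟩
  suc k ℕ.* catalan k ℕ.* (k ! ℕ.* k !)     ≡⟨ cong (ℕ._* (k ! ℕ.* k !)) (catalan-exact k) ⟩
  ((2 ℕ.* k) C k) ℕ.* (k ! ℕ.* k !)         ≡⟨ nCk*k!*l! k k (cong (k ℕ.+_) (sym (ℕ.+-identityʳ k))) ⟩
  (2 ℕ.* k) !                               ∎
  where
  open ≡-Reasoning
  regroup : ∀ k c f → c ℕ.* (f ℕ.* (f ℕ.+ k ℕ.* f)) ≡ suc k ℕ.* c ℕ.* (f ℕ.* f)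
  regroup = solve-∀

catalan≢0 : ∀ k → ℕ.NonZero (catalan k)
catalan≢0 k = ℕ.m*n≢0⇒m≢0 _ {{subst ℕ.NonZero (sym (catalan-! k)) ((2 ℕ.* k) ℕ.!≢0)}}

-- By Pascal's rule an entry of a row is a sum of two adjacent entries of the row above, so
-- induction bounds each of the two summands by half of the power. The induction starts at row 2,
-- because row 1 has 1 + 1 = 2.
nCk+nC[1+k]<2^n : ∀ n k → ((2 ℕ.+ n) C k) ℕ.+ ((2 ℕ.+ n) C suc k) ℕ.< 2 ℕ.^ (2 ℕ.+ n)
nCk+nC[1+k]<2^n zero zero = ℕ.≤-refl
nCk+nC[1+k]<2^n zero (suc zero) = ℕ.≤-refl
nCk+nC[1+k]<2^n zero (suc (suc zero)) = s≤s (s≤s z≤n)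
nCk+nC[1+k]<2^n zero (suc (suc (suc k))) = s≤s z≤n
nCk+nC[1+k]<2^n (suc n) k = begin-strict
  ((3 ℕ.+ n) C k) ℕ.+ ((3 ℕ.+ n) C suc k)
    <⟨ ℕ.+-mono-≤-< (bound k) (subst (ℕ._< 2 ℕ.^ m) (nCk+nC[k+1]≡[n+1]C[k+1] m k) (nCk+nC[1+k]<2^n n k)) ⟩
  2 ℕ.^ m ℕ.+ 2 ℕ.^ m
    ≡⟨ cong (2 ℕ.^ m ℕ.+_) (ℕ.+-identityʳ _) ⟨
  2 ℕ.^ suc m ∎
  where
  open ℕ.≤-Reasoning
  m = 2 ℕ.+ n
  bound : ∀ k → (suc m C k) ℕ.≤ 2 ℕ.^ m
  bound zero    = ℕ.m^n>0 2 m
  bound (suc k) = subst (ℕ._≤ 2 ℕ.^ m) (nCk+nC[k+1]≡[n+1]C[k+1] m k)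
    (ℕ.<⇒≤ (nCk+nC[1+k]<2^n n k))

-- For `e = 0` the coefficient is one of two adjacent entries of row `2 * suc j`; for `e = 1` it is
-- the sum of two such entries.
nearCentral<4^ : ∀ {e} j → e ℕ.≤ 1 →
  ((suc j ℕ.+ (suc j ℕ.+ e)) C suc j) ℕ.< 2 ℕ.^ (2 ℕ.* suc j)
nearCentral<4^ j z≤n = ℕ.≤-<-trans (ℕ.m≤m+n _ _)
  (subst (λ m → (m C suc j) ℕ.+ (m C suc (suc j)) ℕ.< 2 ℕ.^ m)
    (sym (ℕ.*-suc 2 j)) (nCk+nC[1+k]<2^n (2 ℕ.* j) (suc j)))
nearCentral<4^ j (s≤s z≤n) = subst₂ (λ m m′ → (m C suc j) ℕ.< 2 ℕ.^ m′)
  (sym (index j)) (sym (ℕ.*-suc 2 j))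
  (subst (ℕ._< 2 ℕ.^ (2 ℕ.+ 2 ℕ.* j)) (nCk+nC[k+1]≡[n+1]C[k+1] (2 ℕ.+ 2 ℕ.* j) j)
    (nCk+nC[1+k]<2^n (2 ℕ.* j) j))
  where
  index : ∀ j → suc j ℕ.+ (suc j ℕ.+ 1) ≡ 3 ℕ.+ 2 ℕ.* j
  index = solve-∀

-- By absorption `suc j` divides `(suc j + m) * c`; subtract `suc j * c`.
[1+j]∣m*[j+m]Cj : ∀ j m → suc j ℕ.∣ m ℕ.* ((j ℕ.+ m) C j)
[1+j]∣m*[j+m]Cj j m = ℕ.∣m+n∣m⇒∣n
  (subst (suc j ℕ.∣_) (ℕ.*-distribʳ-+ c (suc j) m)
    (subst (suc j ℕ.∣_) (absorption (j ℕ.+ m) j) (ℕ.m∣m*n _)))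
  (ℕ.m∣m*n c)
  where c = (j ℕ.+ m) C j

-- The quotient is the Narayana number N(n+1, j+1), where n = j + k.
[1+j]∣nCj*[1+n]Cj : ∀ j k → suc j ℕ.∣ ((j ℕ.+ k) C j) ℕ.* ((j ℕ.+ suc k) C j)
[1+j]∣nCj*[1+n]Cj j k = ℕ.∣m+n∣m⇒∣n
  -- `A * B` is the difference of `A * (suc k * B)` and `k * A * B`, both multiples of `suc j`.
  (subst (suc j ℕ.∣_) (regroup k A B) (ℕ.∣n⇒∣m*n A ([1+j]∣m*[j+m]Cj j (suc k))))
  (ℕ.∣m⇒∣m*n B ([1+j]∣m*[j+m]Cj j k))
  where
  A = (j ℕ.+ k) C j
  B = (j ℕ.+ suc k) C j
  regroup : ∀ k A B → A ℕ.* (suc k ℕ.* B) ≡ k ℕ.* A ℕ.* B ℕ.+ A ℕ.* B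
  regroup = solve-∀

-- A product of two binomial coefficients is the quotient for `e = 0`. For `e = 1` the divisor gains
-- the factor `suc j` from `suc j !`, and the same product of binomials absorbs it.
factorials-∣ : ∀ {e} j k → e ℕ.≤ 1 →
  (j ! ℕ.* (j ℕ.+ e) !) ℕ.* (k ! ℕ.* suc k !) ℕ.∣ (j ℕ.+ k) ! ℕ.* (j ℕ.+ suc k) !
factorials-∣ j k z≤n rewrite ℕ.+-identityʳ j = subst (ℕ._∣ (j ℕ.+ k) ! ℕ.* (j ℕ.+ suc k) !)
  (ℕ.[m*n]*[o*p]≡[m*o]*[n*p] (j !) (k !) (j !) (suc k !))
  (ℕ.*-pres-∣ (k!*l!∣[k+l]! j k) (k!*l!∣[k+l]! j (suc k)))
factorials-∣ j k (s≤s z≤n) rewrite ℕ.+-comm j 1 = begin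
  (j ! ℕ.* suc j !) ℕ.* (k ! ℕ.* suc k !)
    ≡⟨ regroup (suc j) (j !) (k !) (suc k !) ⟩
  suc j ℕ.* ((j ! ℕ.* k !) ℕ.* (j ! ℕ.* suc k !))
    ∣⟨ ℕ.*-monoˡ-∣ ((j ! ℕ.* k !) ℕ.* (j ! ℕ.* suc k !)) ([1+j]∣nCj*[1+n]Cj j k) ⟩
  (((j ℕ.+ k) C j) ℕ.* ((j ℕ.+ suc k) C j)) ℕ.* ((j ! ℕ.* k !) ℕ.* (j ! ℕ.* suc k !))
    ≡⟨ ℕ.[m*n]*[o*p]≡[m*o]*[n*p] ((j ℕ.+ k) C j) ((j ℕ.+ suc k) C j) (j ! ℕ.* k !) _ ⟩
  (((j ℕ.+ k) C j) ℕ.* (j ! ℕ.* k !)) ℕ.* (((j ℕ.+ suc k) C j) ℕ.* (j ! ℕ.* suc k !))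
    ≡⟨ cong₂ ℕ._*_ (nCk*k!*l! j k refl) (nCk*k!*l! j (suc k) refl) ⟩
  (j ℕ.+ k) ! ℕ.* (j ℕ.+ suc k) ! ∎
  where
  open ℕ.∣-Reasoning
  regroup : ∀ s f g h → (f ℕ.* (s ℕ.* f)) ℕ.* (g ℕ.* h) ≡ s ℕ.* ((f ℕ.* g) ℕ.* (f ℕ.* h))
  regroup = solve-∀

-- The coefficients of the Motzkin polynomials

coefficient : ℕ → ℕ → ℕ
coefficient N k = (N C (2 ℕ.* k)) ℕ.* catalan k

-- The factor (2k)! of the Catalan number cancels against the one in the denominator of the binomial
-- coefficient.
coefficient-! : ∀ {N} k l → 2 ℕ.* k ℕ.+ l ≡ N →
                coefficient N k ℕ.* (k ! ℕ.* suc k !) ℕ.* l ! ≡ N !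
coefficient-! {N} k l eq = begin
  coefficient N k ℕ.* (k ! ℕ.* suc k !) ℕ.* l !
    ≡⟨ regroup (N C (2 ℕ.* k)) (catalan k) (k ! ℕ.* suc k !) (l !) ⟩
  (N C (2 ℕ.* k)) ℕ.* (catalan k ℕ.* (k ! ℕ.* suc k !) ℕ.* l !)
    ≡⟨ cong (λ v → (N C (2 ℕ.* k)) ℕ.* (v ℕ.* l !)) (catalan-! k) ⟩
  (N C (2 ℕ.* k)) ℕ.* ((2 ℕ.* k) ! ℕ.* l !)
    ≡⟨ nCk*k!*l! (2 ℕ.* k) l eq ⟩
  N ! ∎
  where
  open ≡-Reasoning
  regroup : ∀ p c f g → p ℕ.* c ℕ.* f ℕ.* g ≡ p ℕ.* (c ℕ.* f ℕ.* g)
  regroup = solve-∀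

-- After multiplication by `F * G` both `D * X` and `S * c` become `N !`: `D * F` is the factorial
-- that completes `X * G`, and `S * (F * G)` is the product of factorials that completes `c`, as
-- `e ! = 1`.
coefficient-∣ : ∀ {e} j k → e ℕ.≤ 1 →
  let N = 2 ℕ.* (j ℕ.+ k) ℕ.+ e in
  coefficient N (j ℕ.+ k) ℕ.∣ ((j ℕ.+ (j ℕ.+ e)) C j) ℕ.* coefficient N k
coefficient-∣ {e} j k e≤1 with factorials-∣ j k e≤1
... | ℕ.divides S eq = ℕ.divides S (ℕ.*-cancelʳ-≡ (D ℕ.* X) (S ℕ.* c) (F ℕ.* G) (begin
  D ℕ.* X ℕ.* (F ℕ.* G)
    ≡⟨ regroup₁ D X F G ⟩
  X ℕ.* G ℕ.* (D ℕ.* F)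
    ≡⟨ cong (X ℕ.* G ℕ.*_) (nCk*k!*l! j (j ℕ.+ e) refl) ⟩
  X ℕ.* G ℕ.* (j ℕ.+ (j ℕ.+ e)) !
    ≡⟨ coefficient-! k (j ℕ.+ (j ℕ.+ e)) (index j k e) ⟩
  N !
    ≡⟨ coefficient-! n e refl ⟨
  c ℕ.* (n ! ℕ.* suc n !) ℕ.* e !
    ≡⟨ cong (c ℕ.* (n ! ℕ.* suc n !) ℕ.*_) (e!≡1 e≤1) ⟩
  c ℕ.* (n ! ℕ.* suc n !) ℕ.* 1
    ≡⟨ ℕ.*-identityʳ _ ⟩
  c ℕ.* (n ! ℕ.* suc n !)
    ≡⟨ cong (λ v → c ℕ.* (n ! ℕ.* v !)) (ℕ.+-suc j k) ⟨
  c ℕ.* (n ! ℕ.* (j ℕ.+ suc k) !)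
    ≡⟨ cong (c ℕ.*_) eq ⟩
  c ℕ.* (S ℕ.* (F ℕ.* G))
    ≡⟨ regroup₂ c S (F ℕ.* G) ⟩
  S ℕ.* c ℕ.* (F ℕ.* G) ∎))
  where
  open ≡-Reasoning
  n = j ℕ.+ k
  N = 2 ℕ.* n ℕ.+ e
  D = (j ℕ.+ (j ℕ.+ e)) C j
  X = coefficient N k
  c = coefficient N n
  F = j ! ℕ.* (j ℕ.+ e) !
  G = k ! ℕ.* suc k !
  instance
    _ = ℕ.m*n≢0 F G {{j ℕ.!* (j ℕ.+ e) !≢0}} {{k ℕ.!* suc k !≢0}}
  e!≡1 : ∀ {e} → e ℕ.≤ 1 → e ! ≡ 1
  e!≡1 z≤n       = refl
  e!≡1 (s≤s z≤n) = refl
  regroup₁ : ∀ D X F G → D ℕ.* X ℕ.* (F ℕ.* G) ≡ X ℕ.* G ℕ.* (D ℕ.* F)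
  regroup₁ = solve-∀
  regroup₂ : ∀ c S H → c ℕ.* (S ℕ.* H) ≡ S ℕ.* c ℕ.* H
  regroup₂ = solve-∀
  index : ∀ j k e → 2 ℕ.* k ℕ.+ (j ℕ.+ (j ℕ.+ e)) ≡ 2 ℕ.* (j ℕ.+ k) ℕ.+ e
  index = solve-∀

coefficient-^-∣ : ∀ {e} x w j k → e ℕ.≤ 1 →
  let N = 2 ℕ.* (suc j ℕ.+ k) ℕ.+ e in
  x ℕ.^ w ℕ.∣ coefficient N (suc j ℕ.+ k) →
  x ℕ.^ suc (e ℕ.+ w) ℕ.∣ coefficient N k ℕ.* x ℕ.^ (N ∸ 2 ℕ.* k)
coefficient-^-∣ {e} x w j k e≤1 x^w∣c = begin
  x ℕ.^ suc (e ℕ.+ w)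
    ≡⟨ ℕ.^-distribˡ-+-* x (suc e) w ⟩
  x ℕ.^ suc e ℕ.* x ℕ.^ w
    ∣⟨ ℕ.*-monoʳ-∣ (x ℕ.^ suc e) (^-∣-cancel x w m D X {{nCk≢0 (suc j) (suc j ℕ.+ e)}}
         (nearCentral<4^ j e≤1) (ℕ.∣-trans x^w∣c (coefficient-∣ (suc j) k e≤1))) ⟩
  x ℕ.^ suc e ℕ.* (x ℕ.^ m ℕ.* X)
    ≡⟨ ℕ.*-assoc (x ℕ.^ suc e) (x ℕ.^ m) X ⟨
  x ℕ.^ suc e ℕ.* x ℕ.^ m ℕ.* X
    ≡⟨ cong (ℕ._* X) (ℕ.^-distribˡ-+-* x (suc e) m) ⟨
  x ℕ.^ (suc e ℕ.+ m) ℕ.* X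
    ≡⟨ ℕ.*-comm _ X ⟩
  X ℕ.* x ℕ.^ (suc e ℕ.+ m)
    ≡⟨ cong (λ v → X ℕ.* x ℕ.^ v) index ⟨
  X ℕ.* x ℕ.^ (N ∸ 2 ℕ.* k) ∎
  where
  open ℕ.∣-Reasoning
  N = 2 ℕ.* (suc j ℕ.+ k) ℕ.+ e
  D = (suc j ℕ.+ (suc j ℕ.+ e)) C suc j
  X = coefficient N k
  -- `suc m` is `2 * suc j` by definition, as the bound on `D` requires. Of the `2 * suc j + e`
  -- factors `x`, `m` pay for `D` and `suc e` remain.
  m = j ℕ.+ (suc j ℕ.+ 0)
  split : ∀ j k e → 2 ℕ.* (suc j ℕ.+ k) ℕ.+ e ≡ 2 ℕ.* k ℕ.+ (suc e ℕ.+ (j ℕ.+ (suc j ℕ.+ 0)))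
  split = solve-∀
  index : N ∸ 2 ℕ.* k ≡ suc e ℕ.+ m
  index = trans (cong (_∸ 2 ℕ.* k) (split j k e)) (ℕ.m+n∸m≡n (2 ℕ.* k) _)

-- Exponents of integers

x^m∣x^n : ∀ x {m n} → m ℕ.≤ n → x ^ m ∣ x ^ n
x^m∣x^n x {m} m≤n with ℕ.m≤n⇒∃[o]m+o≡n m≤n
... | o , refl = Signed.∣⇒∣ᵤ (subst (x ^ m Signed.∣_) (sym (ℤ.^-distribˡ-+-* x m o))
                   (Signed.∣m⇒∣m*n (x ^ o) Signed.∣-refl))

isGreatestExponent-unique : ∀ {x y e f} →
  IsGreatestExponent x y e → IsGreatestExponent x y f → e ≡ f
isGreatestExponent-unique (p , max) (q , max′) = ℕ.≤-antisym (max′ _ p) (max _ q)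

-- Every power divides 0, so 0 has no greatest exponent.
isGreatestExponent⇒≢0 : ∀ {x y e} → IsGreatestExponent x y e → y ≢ 0ℤ
isGreatestExponent⇒≢0 {x} {e = e} (_ , max) refl = ℕ.1+n≰n (max (suc e) (ℕ._∣0 ∣ x ^ suc e ∣))

-- The factor `a ^ n` is coprime to `x` and contributes nothing, while `x ^ e` contributes exactly
-- `e`. Since `r` is divisible by one power more, it cannot change the exponent.
isGreatestExponent-+ : ∀ {x a y r} n e w → x ≢ 0ℤ → Coprime ∣ x ∣ ∣ a ∣ →
  IsGreatestExponent x y w → x ^ suc (e ℕ.+ w) ∣ r →
  IsGreatestExponent x (r + y * a ^ n * x ^ e) (e ℕ.+ w)
isGreatestExponent-+ {x} {a} {y} {r} n e w x≢0 x⊥a (x^w∣y , max) x^∣r = divides-sum , maximal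
  where
  t = y * a ^ n * x ^ e
  x^ᵉ≢0 : ℤ.NonZero (x ^ e)
  x^ᵉ≢0 = ℤ.≢-nonZero (x≢0 ∘ ℤ.i^n≡0⇒i≡0 x e)
  divides-sum : x ^ (e ℕ.+ w) ∣ r + t
  divides-sum = Signed.∣⇒∣ᵤ (Signed.∣m∣n⇒∣m+n
    (Signed.∣ᵤ⇒∣ {x ^ (e ℕ.+ w)} {r} (ℕ.∣-trans (x^m∣x^n x (ℕ.n≤1+n (e ℕ.+ w))) x^∣r))
    (subst₂ Signed._∣_ (sym (ℤ.^-distribˡ-+-* x e w)) (ℤ.*-comm (x ^ e) (y * a ^ n))
      (Signed.*-monoʳ-∣ (x ^ e) (Signed.∣m⇒∣m*n (a ^ n) (Signed.∣ᵤ⇒∣ {x ^ w} {y} x^w∣y)))))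
  maximal : ∀ f → x ^ f ∣ r + t → f ℕ.≤ e ℕ.+ w
  maximal f x^f∣ with ℕ.≤-<-connex f (e ℕ.+ w)
  ... | inj₁ f≤ = f≤
  -- A larger `f` would make `x ^ suc (e + w)` divide `t`; cancelling `x ^ e` and then `a ^ n`
  -- contradicts the maximality of `w`.
  ... | inj₂ f> = contradiction (max (suc w) x^∣y) ℕ.1+n≰n
    where
    x^∣t : x ^ suc (e ℕ.+ w) Signed.∣ t
    x^∣t = Signed.∣m+n∣m⇒∣n
      (Signed.∣ᵤ⇒∣ {x ^ suc (e ℕ.+ w)} {r + t} (ℕ.∣-trans (x^m∣x^n x f>) x^f∣))
      (Signed.∣ᵤ⇒∣ {x ^ suc (e ℕ.+ w)} {r} x^∣r)
    x^∣ya^n : x ^ suc w ∣ y * a ^ n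
    x^∣ya^n = *-cancelˡ-∣ (x ^ e) {x ^ suc w} {y * a ^ n} {{x^ᵉ≢0}}
      (Signed.∣⇒∣ᵤ (subst₂ Signed._∣_
        (trans (cong (x ^_) (sym (ℕ.+-suc e w))) (ℤ.^-distribˡ-+-* x e (suc w)))
        (ℤ.*-comm (y * a ^ n) (x ^ e)) x^∣t))
    x^∣y : x ^ suc w ∣ y
    x^∣y = coprime-divisor
      (subst₂ Coprime (sym (abs-^ x (suc w))) (sym (abs-^ a n)) (coprime-^ (suc w) n x⊥a))
      (subst (∣ x ^ suc w ∣ ℕ.∣_) (trans (cong ∣_∣ (ℤ.*-comm y (a ^ n))) (ℤ.abs-* (a ^ n) y)) x^∣ya^n)

-- Exponents of the generalized Motzkin numbers

∣-sum : ∀ {d} n (t : Fin n → ℤ) → (∀ i → d Signed.∣ t i) → d Signed.∣ sum t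
∣-sum {d} zero    t d∣t = Signed.∣ᵤ⇒∣ {d} {0ℤ} (ℕ._∣0 ∣ d ∣)
∣-sum     (suc n) t d∣t = Signed.∣m∣n⇒∣m+n (d∣t zero) (∣-sum n (t ∘ suc) (d∣t ∘ suc))

-- `isGreatestExponent-+` with the summand at `n` split off from the others. `IsGreatestExponent`
-- replaces `ω` here because the sum is not yet known to be nonzero; that follows from this result.
motzkin-isGreatestExponent : ∀ {e} n a b w → e ℕ.≤ 1 → b ≢ 0ℤ → Coprime ∣ b ∣ ∣ a ∣ →
  let N = 2 ℕ.* n ℕ.+ e in
  IsGreatestExponent b (+ coefficient N n) w → IsGreatestExponent b (motzkin N a b) (e ℕ.+ w)
motzkin-isGreatestExponent {e} n a b w e≤1 b≢0 b⊥a greatest =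
  subst (λ M → IsGreatestExponent b M (e ℕ.+ w)) (sym motzkin-split)
    (isGreatestExponent-+ {b} {a} {+ coefficient N n} {rest} n e w b≢0 b⊥a greatest
      (Signed.∣⇒∣ᵤ (∣-sum n (term ∘ toℕ ∘ inject₁) (λ i → Signed.∣ᵤ⇒∣ {b ^ suc (e ℕ.+ w)} {term (toℕ (inject₁ i))} (lower i)))))
  where
  N = 2 ℕ.* n ℕ.+ e
  term : ℕ → ℤ
  term k = + (N C (2 ℕ.* k)) * + catalan k * a ^ k * b ^ (N ∸ 2 ℕ.* k)
  rest : ℤ
  rest = sum {n} (term ∘ toℕ ∘ inject₁)
  half : ∀ {e} → e ℕ.≤ 1 → ⌊ 2 ℕ.* n ℕ.+ e /2⌋ ≡ n
  half z≤n rewrite ℕ.+-identityʳ (n ℕ.+ (n ℕ.+ 0)) | ℕ.+-identityʳ n = sym (ℕ.n≡⌊n+n/2⌋ n)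
  -- `⌈ m /2⌉` unfolds to `⌊ suc m /2⌋`.
  half (s≤s z≤n) rewrite ℕ.+-identityʳ n | ℕ.+-comm (n ℕ.+ n) 1 = sym (ℕ.n≡⌈n+n/2⌉ n)
  term-top : term n ≡ + coefficient N n * a ^ n * b ^ e
  term-top = cong₂ (λ c f → c * a ^ n * b ^ f)
    (sym (ℤ.pos-* (N C (2 ℕ.* n)) (catalan n))) (ℕ.m+n∸m≡n (2 ℕ.* n) e)
  motzkin-split : motzkin N a b ≡ rest + + coefficient N n * a ^ n * b ^ e
  motzkin-split = begin
    (∑[ i ≤ ⌊ N /2⌋ ] term (toℕ i))
      ≡⟨ cong (λ m → ∑[ i ≤ m ] term (toℕ i)) (half e≤1) ⟩
    (∑[ i ≤ n ] term (toℕ i))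
      ≡⟨ sum-init-last {n} (term ∘ toℕ) ⟩
    rest + term (toℕ (fromℕ n))
      ≡⟨ cong (_+_ rest) (trans (cong term (toℕ-fromℕ n)) term-top) ⟩
    rest + + coefficient N n * a ^ n * b ^ e ∎
    where open ≡-Reasoning
  -- The power of `b` moves next to the coefficient, where `coefficient-^-∣` applies; the power of
  -- `a` is a spare factor.
  abs-term : ∀ k → ∣ term k ∣ ≡ coefficient N k ℕ.* ∣ b ∣ ℕ.^ (N ∸ 2 ℕ.* k) ℕ.* ∣ a ∣ ℕ.^ k
  abs-term k = begin
    ∣ term k ∣
      ≡⟨ ℤ.abs-* (p * q * a ^ k) (b ^ m) ⟩
    ∣ p * q * a ^ k ∣ ℕ.* ∣ b ^ m ∣
      ≡⟨ cong (ℕ._* ∣ b ^ m ∣) (ℤ.abs-* (p * q) (a ^ k)) ⟩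
    ∣ p * q ∣ ℕ.* ∣ a ^ k ∣ ℕ.* ∣ b ^ m ∣
      ≡⟨ cong (λ v → v ℕ.* ∣ a ^ k ∣ ℕ.* ∣ b ^ m ∣) (ℤ.abs-* p q) ⟩
    coefficient N k ℕ.* ∣ a ^ k ∣ ℕ.* ∣ b ^ m ∣
      ≡⟨ cong₂ (λ u v → coefficient N k ℕ.* u ℕ.* v) (abs-^ a k) (abs-^ b m) ⟩
    coefficient N k ℕ.* ∣ a ∣ ℕ.^ k ℕ.* ∣ b ∣ ℕ.^ m
      ≡⟨ swap (coefficient N k) (∣ a ∣ ℕ.^ k) (∣ b ∣ ℕ.^ m) ⟩
    coefficient N k ℕ.* ∣ b ∣ ℕ.^ m ℕ.* ∣ a ∣ ℕ.^ k ∎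
    where
    open ≡-Reasoning
    p = + (N C (2 ℕ.* k))
    q = + catalan k
    m = N ∸ 2 ℕ.* k
    swap : ∀ x y z → x ℕ.* y ℕ.* z ≡ x ℕ.* z ℕ.* y
    swap = solve-∀
  coefficient-∣-at : ∀ k → k ℕ.< n →
    ∣ b ∣ ℕ.^ suc (e ℕ.+ w) ℕ.∣ coefficient N k ℕ.* ∣ b ∣ ℕ.^ (N ∸ 2 ℕ.* k)
  coefficient-∣-at k k<n with ℕ.m≤n⇒∃[o]m+o≡n k<n
  -- The gap between `k` and `n` is written as `suc j`, since `coefficient-^-∣` needs it positive.
  ... | j , eq with trans (cong suc (ℕ.+-comm j k)) eq
  ...   | refl =
    coefficient-^-∣ ∣ b ∣ w j k e≤1 (subst (ℕ._∣ coefficient N n) (abs-^ b w) (proj₁ greatest))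
  lower : ∀ i → b ^ suc (e ℕ.+ w) ∣ term (toℕ (inject₁ {n} i))
  lower i = subst₂ ℕ._∣_ (sym (abs-^ b (suc (e ℕ.+ w)))) (sym (abs-term k))
    (ℕ.∣m⇒∣m*n (∣ a ∣ ℕ.^ k) (coefficient-∣-at k (subst (ℕ._< n) (sym (toℕ-inject₁ i)) (toℕ<n i))))
    where k = toℕ (inject₁ i)

-- `c` is kept free so that each parity can supply a closed form of the top coefficient. Uniqueness
-- of the greatest exponent then gives the value of `ω`.
motzkin-ω : ∀ {e} n a b {c} → e ℕ.≤ 1 → gcd a b ≡ 1ℤ → b ≢ 0ℤ → b ≢ 1ℤ → b ≢ -1ℤ →
  let N = 2 ℕ.* n ℕ.+ e in
  coefficient N n ≡ c → .{{ℕ.NonZero c}} →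
  motzkin N a b ≢ 0ℤ × ω b (motzkin N a b) ≡ e ℕ.+ ω b (+ c)
motzkin-ω {e} n a b {c} e≤1 a⊥b b≢0 b≢1 b≢-1 refl =
  M≢0 , isGreatestExponent-unique {b} {M} (ω-isGreatestExponent b M b≢0 b≢1 b≢-1 M≢0) greatest
  where
  M = motzkin (2 ℕ.* n ℕ.+ e) a b
  greatest : IsGreatestExponent b M (e ℕ.+ ω b (+ c))
  greatest = motzkin-isGreatestExponent n a b _ e≤1 b≢0
    (Coprimality.sym (gcd≡1⇒coprime (ℤ.+-injective a⊥b)))
    (ω-isGreatestExponent b (+ c) b≢0 b≢1 b≢-1 (ℕ.≢-nonZero⁻¹ c ∘ ℤ.+-injective))
  M≢0 : M ≢ 0ℤ
  M≢0 = isGreatestExponent⇒≢0 {b} {M} greatest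

[m+1]Cm≡m+1 : ∀ m → (m ℕ.+ 1) C m ≡ m ℕ.+ 1
[m+1]Cm≡m+1 m = begin
  (m ℕ.+ 1) C m               ≡⟨ nCk≡nC[n∸k] (ℕ.m≤m+n m 1) ⟩
  (m ℕ.+ 1) C (m ℕ.+ 1 ∸ m)   ≡⟨ cong ((m ℕ.+ 1) C_) (ℕ.m+n∸m≡n m 1) ⟩
  (m ℕ.+ 1) C 1               ≡⟨ nC1≡n (m ℕ.+ 1) ⟩
  m ℕ.+ 1                     ∎
  where open ≡-Reasoning

theorem9 : (n : ℕ) (a b : ℤ) → gcd a b ≡ 1ℤ → b ≢ 0ℤ → b ≢ 1ℤ → b ≢ -1ℤ →
    (motzkin (2 ℕ.* n) a b ≢ 0ℤ ×
    ω b (motzkin (2 ℕ.* n) a b) ≡ ω b (+ catalan n)) ×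
    (motzkin (2 ℕ.* n ℕ.+ 1) a b ≢ 0ℤ ×
    ω b (motzkin (2 ℕ.* n ℕ.+ 1) a b) ≡ 1 ℕ.+ ω b (+ ((2 ℕ.* n ℕ.+ 1) ℕ.* catalan n)))
theorem9 n a b a⊥b b≢0 b≢1 b≢-1 =
  -- `e = 0` yields the index `2 * n + 0`, which does not reduce to `2 * n`.
  subst (λ N → motzkin N a b ≢ 0ℤ × ω b (motzkin N a b) ≡ ω b (+ catalan n))
    (ℕ.+-identityʳ (2 ℕ.* n))
    (motzkin-ω n a b z≤n a⊥b b≢0 b≢1 b≢-1 even-top) ,
  motzkin-ω n a b (s≤s z≤n) a⊥b b≢0 b≢1 b≢-1 odd-top
  where
  instance
    C≢0 = catalan≢0 n
    [2n+1]C≢0 = ℕ.m*n≢0 (2 ℕ.* n ℕ.+ 1) (catalan n)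
      {{subst ℕ.NonZero (ℕ.+-comm 1 (2 ℕ.* n)) _}}
  even-top : coefficient (2 ℕ.* n ℕ.+ 0) n ≡ catalan n
  even-top rewrite ℕ.+-identityʳ (2 ℕ.* n) | nCn≡1 (2 ℕ.* n) = ℕ.*-identityˡ (catalan n)
  odd-top : coefficient (2 ℕ.* n ℕ.+ 1) n ≡ (2 ℕ.* n ℕ.+ 1) ℕ.* catalan n
  odd-top = cong (ℕ._* catalan n) ([m+1]Cm≡m+1 (2 ℕ.* n))
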